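{- Let $d\geq 1$ and $2\leq n_1\leq n_2\leq\cdots\leq n_d$ be integers, and let $G=P_{n_1}\times P_{n_2}\times\cdots\times P_{n_d}$ (the $d$-dimensional grid). Then $$\sigma_T(G)= 2\left(\left\lfloor\tfrac{n_1}{2}\right\rfloor+\left\lfloor\tfrac{n_2}{2}\right\rfloor+\cdots+\left\lfloor\tfrac{n_{d-1}}{2}\right\rfloor\right)+1.$$
   Context: $P_n$ is the path on $n$ vertices and $\times$ is the Cartesian product of graphs: $V(G\times H)=V(G)\times V(H)$, and $(u,v)\sim(u',v')$ iff either $u=u'$ and $vv'\in E(H)$, or $v=v'$ and $uu'\in E(G)$. Thus the vertices of $G$ are vectors $(x_1,\ldots,x_d)$ with $x_i\in\{1,\ldots,n_i\}$, adjacent iff they differ by 1 in exactly one coordinate. For a spanning tree $T$ of a connected graph $G$, $d_T(u,v)$ denotes the distance in $T$, $\sigma_T(G,T):=\max_{uv\in E(G)} d_T(u,v)$, and the tree-stretch of $G$ is $\sigma_T(G):=\min\{\sigma_T(G,T): T \text{ a spanning tree of } G\}$. For $d=1$ the sum is empty (equal to $0$). -}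

module Defs where

open import Data.Nat using (ℕ; zero; suc; _≤_; _/_; _+_; _*_; _∸_)
open import Data.Fin using (Fin)
open import Data.Vec using (Vec; lookup; toList)
open import Data.List using (List; []; _∷_; _++_; [_]; length; take; map)
open import Data.Nat.ListAction using (sum)
open import Data.List.Relation.Unary.Unique.Propositional using (Unique)
open import Data.Product using (Σ; ∃; ∃-syntax; _×_)
open import Data.Sum using (_⊎_)
open import Relation.Binary.PropositionalEquality using (_≡_; _≢_)

InGrid : {d : ℕ} → Vec ℕ d → Vec ℕ d → Set
InGrid {d} ns x = (i : Fin d) → 1 ≤ lookup x i × lookup x i ≤ lookup ns i

GridAdj : {d : ℕ} → Vec ℕ d → Vec ℕ d → Vec ℕ d → Set
GridAdj {d} ns x y =
  InGrid ns x × InGrid ns y ×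
  ∃[ i ] ((lookup x i ≡ suc (lookup y i) ⊎ lookup y i ≡ suc (lookup x i)) ×
          ((j : Fin d) → j ≢ i → lookup x j ≡ lookup y j))

data Walk {V : Set} (R : V → V → Set) : V → V → ℕ → Set where
  here : ∀ {x} → Walk R x x 0
  step : ∀ {x y z k} → R x y → Walk R y z k → Walk R x z (suc k)

DistLe : {V : Set} → (V → V → Set) → V → V → ℕ → Set
DistLe R u v k = ∃[ j ] (j ≤ k × Walk R u v j)

data Chain {V : Set} (R : V → V → Set) : List V → Set where
  nil  : Chain R []
  one  : ∀ {x} → Chain R (x ∷ [])
  cons : ∀ {x y vs} → R x y → Chain R (y ∷ vs) → Chain R (x ∷ y ∷ vs)

Cycle : {V : Set} → (V → V → Set) → Set
Cycle {V} R = Σ V λ x → Σ (List V) λ vs →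
  2 ≤ length vs × Unique (x ∷ vs) × Chain R (x ∷ vs ++ [ x ])

IsSpanningTree : {d : ℕ} → Vec ℕ d → (Vec ℕ d → Vec ℕ d → Set) → Set
IsSpanningTree ns T =
  (∀ x y → T x y → GridAdj ns x y) ×
  (∀ x y → T x y → T y x) ×
  (∀ x y → InGrid ns x → InGrid ns y → ∃[ k ] Walk T x y k) ×
  (Cycle T → Data.Empty.⊥)
  where import Data.Empty

StretchLe : {d : ℕ} → Vec ℕ d → (Vec ℕ d → Vec ℕ d → Set) → ℕ → Set
StretchLe ns T k = ∀ x y → GridAdj ns x y → DistLe T x y k

TreeStretchIs : {d : ℕ} → Vec ℕ d → ℕ → Set₁
TreeStretchIs ns s =
  (∃[ T ] (IsSpanningTree ns T × StretchLe ns T s)) ×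
  (∀ T → IsSpanningTree ns T → ∀ k → StretchLe ns T k → s ≤ k)

halfSumInit : {d : ℕ} → Vec ℕ d → ℕ
halfSumInit {d} ns = sum (map (λ n → n / 2) (take (d ∸ 1) (toList ns)))

{-# OPTIONS --safe #-}

-- Upper bound: keep an edge in direction i only where all earlier coordinates are central.
-- The tree path between the ends of a grid edge in direction i centres the coordinates
-- j < i (at most n_j / 2 steps each), crosses, and undoes the centring.
--
-- Lower bound: send every vertex w to its far corner, and let w point at its first
-- neighbour on the tree path to that corner. Some tree edge w w′ has its ends pointing at
-- each other, so it separates the far corners of w and w′. These two corners lie on a line
-- in the direction of w w′, and on it some grid edge x y is cut by w w′. Its tree path runs
-- from x to w′, to w, to y; in every coordinate off the line x and y are half the side
-- length away from w and w′, and the coordinate lost costs no more than the largest one.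

module Submission where

open import Defs
open import Data.Nat using (ℕ; _≤_; _+_; _*_)
open import Data.Fin using (Fin) renaming (_≤_ to _≤ᶠ_)
open import Data.Vec using (Vec; lookup)
open import Data.Nat using (zero; suc; _<_; _/_; _%_; z≤n; s≤s; s≤s⁻¹; z<s; ∣_-_∣)
open import Data.Nat.Properties hiding (suc-injective)
open import Data.Nat.DivMod using (m≡m%n+[m/n]*n; m%n<n; m/n*n≤m; m/n<m; /-monoˡ-≤)
open import Data.Nat.Tactic.RingSolver using (solve-∀)
open import Data.Fin using (zero; suc; fromℕ)
open import Data.Fin.Properties using (≤fromℕ; suc-injective)
open import Data.Vec using ([]; _∷_; map; zipWith)
open import Data.Vec.Properties using (≡-dec; ∷-injectiveˡ)
open import Data.Vec.Relation.Binary.Pointwise.Extensional using (ext; Pointwise-≡⇒≡)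
open import Data.List using (List; []; _∷_; _++_; [_]; length; upTo; cartesianProductWith)
open import Data.List.Properties using (++-assoc; length-++-sucʳ)
open import Data.List.Membership.Propositional using (_∈_)
open import Data.List.Membership.Propositional.Properties using (∈-∃++; ∈-++⁻; ∈-++⁺ˡ; ∈-++⁺ʳ; ∈-upTo⁺; ∈-cartesianProductWith⁺)
open import Data.List.Relation.Unary.Any using (here; there)
open import Data.List.Relation.Unary.All as All using (All; []; _∷_)
open import Data.List.Relation.Unary.All.Properties using (++⁻ˡ; ++⁻ʳ; ¬Any⇒All¬)
open import Data.List.Relation.Unary.AllPairs using ([]; _∷_)
import Data.List.Relation.Unary.AllPairs.Properties as AllPairs
open import Data.List.Relation.Unary.Unique.Propositional using (Unique)
open import Data.List.Relation.Unary.Unique.Propositional.Properties using (Unique[x∷xs]⇒x∉xs)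
import Data.List.Membership.DecPropositional as DecMembership
open import Data.Product using (∃₂; ∃-syntax; _×_; _,_; proj₁; proj₂; swap)
open import Data.Sum using (_⊎_; inj₁; inj₂)
open import Data.Empty using (⊥; ⊥-elim)
open import Function using (_∘_; id)
open import Relation.Nullary using (¬_; yes; no; contradiction)
open import Relation.Binary.Definitions using (DecidableEquality)
open import Relation.Binary.PropositionalEquality using (_≡_; _≢_; refl; sym; trans; cong; cong₂; subst)

-- Walks and chains

walk-++ : {V : Set} {R : V → V → Set} {x y z : V} {k l : ℕ} →
  Walk R x y k → Walk R y z l → Walk R x z (k + l)
walk-++ here       v = v
walk-++ (step e w) v = step e (walk-++ w v)

walk-reverse : {V : Set} {R : V → V → Set} {x y : V} {k : ℕ} →
  (∀ {u v} → R u v → R v u) → Walk R x y k → Walk R y x k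
walk-reverse R-sym here = here
walk-reverse {R = R} R-sym (step {k = k} e w) =
  subst (Walk R _ _) (+-comm k 1) (walk-++ (walk-reverse R-sym w) (step (R-sym e) here))

walk-map : {V W : Set} {R : V → V → Set} {S : W → W → Set} {x y : V} {k : ℕ} (g : V → W) →
  (∀ {u v} → R u v → S (g u) (g v)) → Walk R x y k → Walk S (g x) (g y) k
walk-map g f here       = here
walk-map g f (step e w) = step (f e) (walk-map g f w)

walk-invariant : {V : Set} {R : V → V → Set} {P : V → Set} {x y : V} {k : ℕ} →
  (∀ {u v} → R u v → P u → P v) → P x →
  Walk R x y k → Walk (λ u v → R u v × P u × P v) x y k
walk-invariant pres px here       = here
walk-invariant pres px (step e w) = step (e , px , pres e px) (walk-invariant pres (pres e px) w)

chain-map : {V : Set} {R S : V → V → Set} {xs : List V} →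
  (∀ {u v} → R u v → S u v) → Chain R xs → Chain S xs
chain-map f nil        = nil
chain-map f one        = one
chain-map f (cons e c) = cons (f e) (chain-map f c)

chain-tail : {V : Set} {R : V → V → Set} {x : V} {xs : List V} → Chain R (x ∷ xs) → Chain R xs
chain-tail one        = nil
chain-tail (cons _ c) = c

chain-++⁻ʳ : {V : Set} {R : V → V → Set} (xs : List V) {ys : List V} → Chain R (xs ++ ys) → Chain R ys
chain-++⁻ʳ []       c = c
chain-++⁻ʳ (x ∷ xs) c = chain-++⁻ʳ xs (chain-tail c)

chain-prefix : {V : Set} {R : V → V → Set} (xs : List V) {v : V} {ys : List V} →
  Chain R (xs ++ v ∷ ys) → Chain R (xs ++ [ v ])
chain-prefix []           c          = one
chain-prefix (x ∷ [])     (cons e c) = cons e one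
chain-prefix (x ∷ y ∷ xs) (cons e c) = cons e (chain-prefix (y ∷ xs) c)

unique-++⁻ʳ : {V : Set} (xs : List V) {ys : List V} → Unique (xs ++ ys) → Unique ys
unique-++⁻ʳ []       u       = u
unique-++⁻ʳ (x ∷ xs) (_ ∷ u) = unique-++⁻ʳ xs u

unique-front : {V : Set} (xs : List V) {v : V} {ys : List V} →
  Unique (xs ++ v ∷ ys) → Unique (v ∷ xs)
unique-front []       u        = [] ∷ []
unique-front (x ∷ xs) (px ∷ u) with unique-front xs u
... | pv ∷ ux = ((All.head (++⁻ʳ xs px) ∘ sym) ∷ pv) ∷ (++⁻ˡ xs px ∷ ux)

unique-rotate : {V : Set} {x : V} {xs : List V} → Unique (x ∷ xs) → Unique (xs ++ [ x ])
unique-rotate (px ∷ u) = AllPairs.++⁺ u ([] ∷ []) (All.map (λ x≢y → (x≢y ∘ sym) ∷ []) px)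

-- Pigeonhole principle: the head of `xs` is deleted from `ys`, and distinctness keeps the other
-- elements in what remains.
unique-⊆⇒length≤ : {V : Set} {xs ys : List V} →
  Unique xs → (∀ {x} → x ∈ xs → x ∈ ys) → length xs ≤ length ys
unique-⊆⇒length≤ [] _ = z≤n
unique-⊆⇒length≤ {xs = x ∷ xs} (px ∷ u) sub with ∈-∃++ (sub (here refl))
... | pre , post , refl = subst (suc (length xs) ≤_) (sym (length-++-sucʳ pre x post))
    (s≤s (unique-⊆⇒length≤ u sub′))
  where
  sub′ : ∀ {y} → y ∈ xs → y ∈ pre ++ post
  sub′ y∈ with ∈-++⁻ pre (sub (there y∈))
  ... | inj₁ y∈pre            = ∈-++⁺ˡ y∈pre
  ... | inj₂ (here y≡x)       = contradiction (sym y≡x) (All.lookup px y∈)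
  ... | inj₂ (there y∈post)   = ∈-++⁺ʳ pre y∈post

-- Loop erasure: if the new start already occurs on the path found so far, the path is cut back to
-- that occurrence. The endpoint `y` heads the duplicate-free list because an edge from `y` to `x`
-- then closes the path in the form that `Cycle` asks for.
simple-path : {V : Set} {R : V → V → Set} {x y : V} {k : ℕ} → DecidableEquality V →
  Walk R x y k → x ≢ y → ∃[ vs ] (Unique (y ∷ x ∷ vs) × Chain R (x ∷ vs ++ [ y ]))
simple-path _≟_ here x≢x = contradiction refl x≢x
simple-path {R = R} {x} {y} _≟_ (step {y = z} e w) x≢y with z ≟ y
... | yes refl = [] , ((x≢y ∘ sym) ∷ []) ∷ [] ∷ [] , cons e one
... | no z≢y with simple-path _≟_ w z≢y
...   | vs , (py ∷ u) , c with DecMembership._∈?_ _≟_ x (z ∷ vs)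
...     | no x∉ = z ∷ vs , ((x≢y ∘ sym) ∷ py) ∷ ¬Any⇒All¬ _ x∉ ∷ u , cons e c
...     | yes x∈ with ∈-∃++ x∈
...       | pre , post , eq =
  post ,
  ++⁻ʳ pre (subst (All (y ≢_)) eq py) ∷ unique-++⁻ʳ pre (subst Unique eq u) ,
  chain-++⁻ʳ pre (subst (Chain R) (trans (cong (_++ [ y ]) eq) (++-assoc pre (x ∷ post) [ y ])) c)

-- Cycles

-- The assumption `¬ R x y` gives the simple path an inner vertex, so that the closed path is long
-- enough to be a cycle. The closing edge belongs to `S` only: in the application `R` is a tree
-- without one edge.
close-walk : {V : Set} {R S : V → V → Set} {x y : V} {k : ℕ} → DecidableEquality V →
  (∀ {u v} → R u v → S u v) → Walk R x y k → x ≢ y → ¬ R x y → S y x → Cycle S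
close-walk _≟_ R⇒S w x≢y ¬xy yx with simple-path _≟_ w x≢y
... | []     , u , cons xy one = contradiction xy ¬xy
... | v ∷ vs , u , c           = _ , _ ∷ v ∷ vs , s≤s (s≤s z≤n) , u , cons yx (chain-map R⇒S c)

-- Following the pointers revisits a vertex; unless it is the previous one, that closes a cycle.
mutual-pointers : {V : Set} {T P : V → V → Set} {G : V → Set} → DecidableEquality V →
  ¬ Cycle T → (∀ {x y} → P x y → T y x) → (∀ {x y} → P x y → x ≢ y) →
  (∀ {x} → G x → ∃[ y ] (G y × P x y)) → (L : List V) → (∀ {x} → G x → x ∈ L) →
  (x₀ : V) → G x₀ → ∃₂ λ x y → G x × G y × P x y × P y x
mutual-pointers {V} {T} {P} {G} _≟_ acyclic P⇒T P-irrefl next L G⇒∈L x₀ g₀ =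
  follow (length L) x₀ [] ([] ∷ []) (g₀ ∷ []) one (≤-reflexive (+-comm 1 (length L)))
  where
  -- The visited vertices are kept newest first, and `n` is fuel: once it runs out, more distinct
  -- vertices have been visited than `L` has entries.
  follow : ∀ n v p → Unique (v ∷ p) → All G (v ∷ p) → Chain (λ x y → P y x) (v ∷ p) →
    length L < n + length (v ∷ p) → ∃₂ λ x y → G x × G y × P x y × P y x
  follow zero v p u gs c bound =
    contradiction (unique-⊆⇒length≤ u (λ x∈ → G⇒∈L (All.lookup gs x∈))) (<⇒≱ bound)
  follow (suc n) v p u gs@(gv ∷ _) c bound with next gv
  ... | y , gy , vy with DecMembership._∈?_ _≟_ y (v ∷ p)
  ...   | no y∉ = follow n y (v ∷ p) (¬Any⇒All¬ _ y∉ ∷ u) (gy ∷ gs) (cons vy c)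
                    (subst (length L <_) (sym (+-suc n _)) bound)
  ...   | yes y∈ with ∈-∃++ y∈
  ...     | [] , post , refl = contradiction refl (P-irrefl vy)
  ...     | _ ∷ [] , post , refl with c
  ...       | cons yv _ = v , y , gv , gy , vy , yv
  follow (suc n) v p u gs@(gv ∷ _) c bound
      | y , gy , vy | yes y∈ | pre@(_ ∷ _ ∷ _) , post , refl =
    ⊥-elim (acyclic (y , pre , s≤s (s≤s z≤n) , unique-front pre u ,
      chain-map P⇒T (chain-prefix (y ∷ pre) (cons vy c))))

data NonBacktracking {V : Set} : List V → Set where
  short : ∀ {x y} → NonBacktracking (x ∷ y ∷ [])
  extend : ∀ {x y z zs} → x ≢ z → NonBacktracking (y ∷ z ∷ zs) → NonBacktracking (x ∷ y ∷ z ∷ zs)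

unique⇒nonBacktracking : {V : Set} {x y : V} {zs : List V} →
  Unique (x ∷ y ∷ zs) → NonBacktracking (x ∷ y ∷ zs)
unique⇒nonBacktracking {zs = []}     _                       = short
unique⇒nonBacktracking {zs = z ∷ zs} ((_ ∷ x≢z ∷ _) ∷ u) = extend x≢z (unique⇒nonBacktracking u)

nonBacktracking-tail : {V : Set} {x y z : V} (ws : List V) →
  NonBacktracking (x ∷ y ∷ ws ++ [ z ]) → NonBacktracking (y ∷ ws ++ [ z ])
nonBacktracking-tail []      (extend _ nb) = nb
nonBacktracking-tail (_ ∷ _) (extend _ nb) = nb

-- A non-backtracking walk that once moves away from the root does so forever;
-- hence the two neighbours on a cycle of a vertex followed by its parent would both be its parent.
parents⇒acyclic : {V : Set} {T Parent : V → V → Set} (ρ : V → ℕ) →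
  (∀ {x y} → Parent x y → ρ y < ρ x) → (∀ {x y z} → Parent x y → Parent x z → y ≡ z) →
  (∀ {x y} → T x y → Parent x y ⊎ Parent y x) → ¬ Cycle T
parents⇒acyclic {V} {T} {Parent} ρ lower functional orient
    (_ , _ ∷ [] , s≤s () , _)
parents⇒acyclic {V} {T} {Parent} ρ lower functional orient
    (x , a ∷ b ∷ vs , _ , u@((_ ∷ x≢b ∷ _) ∷ ua) , cons xa c@(cons ab c′)) = go
  where
  -- The walk has just moved from `p` to its child `q`. The only way back toward the root is through
  -- `p`, which is excluded, so each further step goes to a child and `z` is entered from its
  -- parent.
  ascend : ∀ {p q} l {z} → Parent q p → Chain T (q ∷ l ++ [ z ]) →
    NonBacktracking (p ∷ q ∷ l ++ [ z ]) → ρ q < ρ z × ∃[ m ] (m ∈ q ∷ l × Parent z m)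
  ascend [] qp (cons qz one) (extend p≢z _) with orient qz
  ... | inj₁ q↓z = contradiction (functional qp q↓z) p≢z
  ... | inj₂ z↓q = lower z↓q , _ , here refl , z↓q
  ascend (r ∷ l) qp (cons qr c) (extend p≢r nb) with orient qr
  ... | inj₁ q↓r = contradiction (functional qp q↓r) p≢r
  ... | inj₂ r↓q with ascend l r↓q c nb
  ...   | r<z , m , m∈ , zm = <-trans (lower r↓q) r<z , m , there m∈ , zm

  -- Either every step goes to a parent, or the walk turns at some point and `ascend` takes over.
  descend : ∀ {q} l {z} → Chain T (q ∷ l ++ [ z ]) → NonBacktracking (q ∷ l ++ [ z ]) →
    ρ z < ρ q ⊎ ∃[ m ] (m ∈ q ∷ l × Parent z m)
  descend [] (cons qz one) _ with orient qz
  ... | inj₁ q↓z = inj₁ (lower q↓z)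
  ... | inj₂ z↓q = inj₂ (_ , here refl , z↓q)
  descend (r ∷ l) (cons qr c) nb with orient qr
  descend (r ∷ l) (cons qr c) nb | inj₂ r↓q with ascend l r↓q c nb
  ... | _ , m , m∈ , zm = inj₂ (m , there m∈ , zm)
  descend (r ∷ l) (cons qr c) nb | inj₁ q↓r with descend l c (nonBacktracking-tail l nb)
  ... | inj₁ z<r           = inj₁ (<-trans z<r (lower q↓r))
  ... | inj₂ (m , m∈ , zm) = inj₂ (m , there m∈ , zm)

  nb : NonBacktracking (a ∷ b ∷ vs ++ [ x ])
  nb = unique⇒nonBacktracking (unique-rotate u)

  go : ⊥
  -- Going around from `x`, the rank would rise or fall strictly all the way, or the walk re-enters
  -- `x` from its parent. In the last case that parent is `a`, which then occurs twice on the cycle.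
  go with orient xa
  ... | inj₂ a↓x = <-asym (lower a↓x) (proj₁ (ascend (b ∷ vs) a↓x c (extend x≢b nb)))
  ... | inj₁ x↓a with orient ab
  ...   | inj₂ b↓a with ascend vs b↓a c′ nb
  ...     | _ , m , m∈ , x↓m with functional x↓a x↓m
  ...       | refl = Unique[x∷xs]⇒x∉xs ua m∈
  go | inj₁ x↓a | inj₁ a↓b with descend vs c′ (nonBacktracking-tail vs nb)
  ... | inj₁ x<b = <-asym (<-trans x<b (lower a↓b)) (lower x↓a)
  ... | inj₂ (m , m∈ , x↓m) with functional x↓a x↓m
  ...   | refl = Unique[x∷xs]⇒x∉xs ua m∈

-- Grid points

infix 4 _∼_

-- Adjacency by recursion on the coordinates, without the bounds of the grid; this suits the
-- inductions on the dimension.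
data _∼_ : {d : ℕ} → Vec ℕ d → Vec ℕ d → Set where
  now   : ∀ {d x y} {xs : Vec ℕ d} → x ≡ suc y ⊎ y ≡ suc x → (x ∷ xs) ∼ (y ∷ xs)
  later : ∀ {d x} {xs ys : Vec ℕ d} → xs ∼ ys → (x ∷ xs) ∼ (x ∷ ys)

GridAdj⇒∼ : {d : ℕ} (ns : Vec ℕ d) {x y : Vec ℕ d} → GridAdj ns x y → x ∼ y
GridAdj⇒∼ _ (_ , _ , i , differ , agree) = go i _ _ differ agree
  where
  go : ∀ {d} (i : Fin d) (x y : Vec ℕ d) → lookup x i ≡ suc (lookup y i) ⊎ lookup y i ≡ suc (lookup x i) →
    (∀ j → j ≢ i → lookup x j ≡ lookup y j) → x ∼ y
  go zero (x ∷ xs) (y ∷ ys) differ agree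
    with refl ← Pointwise-≡⇒≡ {xs = xs} {ys} (ext λ j → agree (suc j) λ ()) = now differ
  go (suc i) (x ∷ xs) (y ∷ ys) differ agree with refl ← agree zero (λ ()) =
    later (go i xs ys differ (λ j j≢i → agree (suc j) (j≢i ∘ suc-injective)))

∼⇒GridAdj : {d : ℕ} (ns : Vec ℕ d) {x y : Vec ℕ d} → InGrid ns x → InGrid ns y → x ∼ y → GridAdj ns x y
∼⇒GridAdj _ gx gy x∼y = gx , gy , go x∼y
  where
  go : ∀ {d} {x y : Vec ℕ d} → x ∼ y → ∃[ i ] ((lookup x i ≡ suc (lookup y i) ⊎ lookup y i ≡ suc (lookup x i)) ×
    (∀ j → j ≢ i → lookup x j ≡ lookup y j))
  go (now differ) = zero , differ , λ { zero j≢i → contradiction refl j≢i ; (suc j) _ → refl }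
  go (later x∼y) with go x∼y
  ... | i , differ , agree = suc i , differ ,
    λ { zero _ → refl ; (suc j) j≢i → agree j (j≢i ∘ cong suc) }

∼-irrefl : {d : ℕ} {x y : Vec ℕ d} → x ∼ y → x ≢ y
∼-irrefl (now (inj₁ ())) refl
∼-irrefl (now (inj₂ ())) refl
∼-irrefl (later x∼y) refl = ∼-irrefl x∼y refl

inGrid-∷ : {d n x : ℕ} {ns xs : Vec ℕ d} → 1 ≤ x × x ≤ n → InGrid ns xs → InGrid (n ∷ ns) (x ∷ xs)
inGrid-∷ gx gxs zero    = gx
inGrid-∷ gx gxs (suc i) = gxs i

gridPoints : {d : ℕ} → Vec ℕ d → List (Vec ℕ d)
gridPoints []       = [ [] ]
gridPoints (n ∷ ns) = cartesianProductWith _∷_ (upTo (suc n)) (gridPoints ns)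

∈-gridPoints : {d : ℕ} (ns : Vec ℕ d) {x : Vec ℕ d} → InGrid ns x → x ∈ gridPoints ns
∈-gridPoints []       {[]}        g = here refl
∈-gridPoints (n ∷ ns) {x ∷ xs} g =
  ∈-cartesianProductWith⁺ _∷_ (∈-upTo⁺ (s≤s (proj₂ (g zero)))) (∈-gridPoints ns (g ∘ suc))

-- Taxicab distance

∥_-_∥ : {d : ℕ} → Vec ℕ d → Vec ℕ d → ℕ
∥ [] - [] ∥             = 0
∥ x ∷ xs - y ∷ ys ∥ = ∣ x - y ∣ + ∥ xs - ys ∥

∥x-x∥≡0 : {d : ℕ} (x : Vec ℕ d) → ∥ x - x ∥ ≡ 0
∥x-x∥≡0 []       = refl
∥x-x∥≡0 (x ∷ xs) = cong₂ _+_ (∣n-n∣≡0 x) (∥x-x∥≡0 xs)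

∣1+n-n∣≡1 : ∀ n → ∣ suc n - n ∣ ≡ 1
∣1+n-n∣≡1 zero    = refl
∣1+n-n∣≡1 (suc n) = ∣1+n-n∣≡1 n

∼⇒∥-∥≤ : {d : ℕ} {x y : Vec ℕ d} (z : Vec ℕ d) → x ∼ y → ∥ x - z ∥ ≤ suc ∥ y - z ∥
∼⇒∥-∥≤ {x = x ∷ xs} {y ∷ _} (z ∷ zs) (now differ) = +-monoˡ-≤ ∥ xs - zs ∥
  (≤-trans (∣-∣-triangle x y z) (≤-reflexive (cong (_+ ∣ y - z ∣) (unit differ))))
  where
  unit : ∀ {x y} → x ≡ suc y ⊎ y ≡ suc x → ∣ x - y ∣ ≡ 1
  unit {y = y} (inj₁ refl) = ∣1+n-n∣≡1 y
  unit {x = x} (inj₂ refl) = trans (∣-∣-comm x (suc x)) (∣1+n-n∣≡1 x)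
∼⇒∥-∥≤ {x = x ∷ _} (z ∷ zs) (later x∼y) =
  ≤-trans (+-monoʳ-≤ ∣ x - z ∣ (∼⇒∥-∥≤ zs x∼y)) (≤-reflexive (+-suc ∣ x - z ∣ _))

walk⇒∥-∥≤ : {d : ℕ} {R : Vec ℕ d → Vec ℕ d → Set} {x y : Vec ℕ d} {k : ℕ} →
  (∀ {u v} → R u v → u ∼ v) → Walk R x y k → ∥ x - y ∥ ≤ k
walk⇒∥-∥≤ R⇒∼ (here {x}) = ≤-reflexive (∥x-x∥≡0 x)
walk⇒∥-∥≤ {y = y} R⇒∼ (step e w) = ≤-trans (∼⇒∥-∥≤ y (R⇒∼ e)) (s≤s (walk⇒∥-∥≤ R⇒∼ w))

-- Unit steps along one coordinate

data Toward (c : ℕ) : ℕ → ℕ → Set where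
  down : ∀ {y} → c ≤ y → Toward c (suc y) y
  up   : ∀ {x} → x < c → Toward c x (suc x)

toward⇒± : ∀ {c x y} → Toward c x y → x ≡ suc y ⊎ y ≡ suc x
toward⇒± (down _) = inj₁ refl
toward⇒± (up _)   = inj₂ refl

-- No unit step leaves the distance to `c` unchanged, so every edge of the line points toward `c` in
-- one of its two orientations.
±⇒toward : ∀ {x y} c → x ≡ suc y ⊎ y ≡ suc x → Toward c x y ⊎ Toward c y x
±⇒toward {y = y} c (inj₁ refl) with c ≤? y
... | yes c≤y = inj₁ (down c≤y)
... | no c≰y  = inj₂ (up (≰⇒> c≰y))
±⇒toward {x = x} c (inj₂ refl) with c ≤? x
... | yes c≤x = inj₂ (down c≤x)
... | no c≰x  = inj₁ (up (≰⇒> c≰x))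

toward-functional : ∀ {c x y z} → Toward c x y → Toward c x z → y ≡ z
toward-functional (down _)   (down _)   = refl
toward-functional (up _)     (up _)     = refl
toward-functional (down c≤y) (up y<c)   = contradiction (≤-trans (n≤1+n _) y<c) (≤⇒≯ c≤y)
toward-functional (up y<c)   (down c≤y) = contradiction (≤-trans (n≤1+n _) y<c) (≤⇒≯ c≤y)

toward⇒∣-∣ : ∀ {c x y} → Toward c x y → ∣ x - c ∣ ≡ suc ∣ y - c ∣
toward⇒∣-∣ {zero}  (down {zero} _)          = refl
toward⇒∣-∣ {zero}  (down {suc _} _)         = refl
toward⇒∣-∣ {suc c} (down {suc _} (s≤s c≤y)) = toward⇒∣-∣ (down c≤y)
toward⇒∣-∣ {suc c} (up {zero} _)            = refl
toward⇒∣-∣ {suc c} (up {suc _} (s≤s x<c))   = toward⇒∣-∣ (up x<c)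

toward-suc : ∀ {c x y} → Toward c x y → Toward (suc c) (suc x) (suc y)
toward-suc (down c≤y) = down (s≤s c≤y)
toward-suc (up x<c)   = up (s≤s x<c)

toward-walk : ∀ x c → Walk (Toward c) x c ∣ x - c ∣
toward-walk zero    zero    = here
toward-walk zero    (suc c) = step (up z<s) (walk-map suc toward-suc (toward-walk zero c))
toward-walk (suc x) zero    =
  step (down z≤n) (subst (Walk (Toward 0) x 0) (∣-∣-identityʳ x) (toward-walk x zero))
toward-walk (suc x) (suc c) = walk-map suc toward-suc (toward-walk x c)

toward-between : ∀ {n c x y} → 1 ≤ c × c ≤ n → Toward c x y → 1 ≤ x × x ≤ n → 1 ≤ y × y ≤ n
toward-between (1≤c , _) (down c≤y) (_ , y<n) = ≤-trans 1≤c c≤y , <⇒≤ y<n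
toward-between (_ , c≤n) (up x<c)   _         = s≤s z≤n , ≤-trans x<c c≤n

toward-between-walk : ∀ {n x c} → 1 ≤ x × x ≤ n → 1 ≤ c × c ≤ n →
  Walk (λ u v → Toward c u v × (1 ≤ u × u ≤ n) × (1 ≤ v × v ≤ n)) x c ∣ x - c ∣
toward-between-walk {x = x} {c} gx gc = walk-invariant (toward-between gc) gx (toward-walk x c)

-- The comb tree

center : ℕ → ℕ
center n = suc (n / 2)

center-between : ∀ {n} → 2 ≤ n → 1 ≤ center n × center n ≤ n
center-between {suc n} _ = s≤s z≤n , m/n<m (suc n) 2 (s≤s (s≤s z≤n))

n≤1+2[n/2] : ∀ n → n ≤ suc (n / 2 + n / 2)
n≤1+2[n/2] n = begin
  n                       ≡⟨ m≡m%n+[m/n]*n n 2 ⟩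
  n % 2 + (n / 2) * 2     ≤⟨ +-mono-≤ (s≤s⁻¹ (m%n<n n 2)) (≤-reflexive (trans (*-comm (n / 2) 2) (cong (n / 2 +_) (+-identityʳ (n / 2))))) ⟩
  suc (n / 2 + n / 2)     ∎
  where open ≤-Reasoning

2[n/2]≤n : ∀ n → n / 2 + n / 2 ≤ n
2[n/2]≤n n = ≤-trans (≤-reflexive (trans (cong (n / 2 +_) (sym (+-identityʳ (n / 2)))) (*-comm 2 (n / 2)))) (m/n*n≤m n 2)

∣x-center∣≤n/2 : ∀ {n x} → 1 ≤ x × x ≤ n → ∣ x - center n ∣ ≤ n / 2
∣x-center∣≤n/2 {n} {x} (1≤x , x≤n) with ≤-total x (center n)
... | inj₁ x≤c = ≤-trans (≤-reflexive (m≤n⇒∣m-n∣≡n∸m x≤c)) (∸-monoʳ-≤ (center n) 1≤x)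
... | inj₂ c≤x = ≤-trans (≤-reflexive (m≤n⇒∣n-m∣≡n∸m c≤x))
  (m≤n+o⇒m∸n≤o x (center n) (≤-trans x≤n (n≤1+2[n/2] n)))

-- The first non-central coordinate moves one step toward its centre: `later` forces the head to be
-- central already. The root is the point `cs`, which has no parent.
data Parent : {d : ℕ} → Vec ℕ d → Vec ℕ d → Vec ℕ d → Set where
  now   : ∀ {d c x y} {cs xs : Vec ℕ d} → Toward c x y → Parent (c ∷ cs) (x ∷ xs) (y ∷ xs)
  later : ∀ {d c} {cs xs ys : Vec ℕ d} → Parent cs xs ys → Parent (c ∷ cs) (c ∷ xs) (c ∷ ys)

parent⇒∼ : {d : ℕ} {cs x y : Vec ℕ d} → Parent cs x y → x ∼ y
parent⇒∼ (now t)   = now (toward⇒± t)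
parent⇒∼ (later p) = later (parent⇒∼ p)

∼-sym : {d : ℕ} {x y : Vec ℕ d} → x ∼ y → y ∼ x
∼-sym (now (inj₁ e)) = now (inj₂ e)
∼-sym (now (inj₂ e)) = now (inj₁ e)
∼-sym (later x∼y)    = later (∼-sym x∼y)

parent-lower : {d : ℕ} {cs x y : Vec ℕ d} → Parent cs x y → ∥ y - cs ∥ < ∥ x - cs ∥
parent-lower {cs = _ ∷ cs} {_ ∷ xs} (now t) =
  +-monoˡ-< ∥ xs - cs ∥ (≤-reflexive (sym (toward⇒∣-∣ t)))
parent-lower {cs = c ∷ _} (later p) = +-monoʳ-< ∣ c - c ∣ (parent-lower p)

toward-moves : ∀ {c y} → ¬ Toward c c y
toward-moves (down c<c) = <-irrefl refl c<c
toward-moves (up c<c)   = <-irrefl refl c<c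

parent-functional : {d : ℕ} {cs x y z : Vec ℕ d} → Parent cs x y → Parent cs x z → y ≡ z
parent-functional (now t)   (now t′)   = cong (_∷ _) (toward-functional t t′)
parent-functional (now t)   (later _)  = ⊥-elim (toward-moves t)
parent-functional (later _) (now t)    = ⊥-elim (toward-moves t)
parent-functional (later p) (later p′) = cong (_ ∷_) (parent-functional p p′)

Comb : {d : ℕ} → Vec ℕ d → Vec ℕ d → Vec ℕ d → Set
Comb ns x y = InGrid ns x × InGrid ns y × (Parent (map center ns) x y ⊎ Parent (map center ns) y x)

comb⇒∼ : {d : ℕ} {ns x y : Vec ℕ d} → Comb ns x y → x ∼ y
comb⇒∼ (_ , _ , inj₁ p) = parent⇒∼ p
comb⇒∼ (_ , _ , inj₂ p) = ∼-sym (parent⇒∼ p)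

comb-sym : {d : ℕ} {ns x y : Vec ℕ d} → Comb ns x y → Comb ns y x
comb-sym (gx , gy , inj₁ p) = gy , gx , inj₂ p
comb-sym (gx , gy , inj₂ p) = gy , gx , inj₁ p

comb-later : {d n : ℕ} {ns xs ys : Vec ℕ d} → 2 ≤ n →
  Comb ns xs ys → Comb (n ∷ ns) (center n ∷ xs) (center n ∷ ys)
comb-later 2≤n (gx , gy , inj₁ p) =
  inGrid-∷ (center-between 2≤n) gx , inGrid-∷ (center-between 2≤n) gy , inj₁ (later p)
comb-later 2≤n (gx , gy , inj₂ p) =
  inGrid-∷ (center-between 2≤n) gx , inGrid-∷ (center-between 2≤n) gy , inj₂ (later p)

comb-center-head : {d n x : ℕ} {ns xs : Vec ℕ d} → 2 ≤ n → InGrid (n ∷ ns) (x ∷ xs) →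
  Walk (Comb (n ∷ ns)) (x ∷ xs) (center n ∷ xs) ∣ x - center n ∣
comb-center-head {xs = xs} 2≤n g = walk-map (_∷ xs)
  (λ { (t , gu , gv) → inGrid-∷ gu (g ∘ suc) , inGrid-∷ gv (g ∘ suc) , inj₁ (now t) })
  (toward-between-walk (g zero) (center-between 2≤n))

comb-walk-to-root : {d : ℕ} {ns x : Vec ℕ d} → (∀ i → 2 ≤ lookup ns i) → InGrid ns x →
  ∃[ k ] Walk (Comb ns) x (map center ns) k
comb-walk-to-root {ns = []}     {[]}     2≤ns g = 0 , here
comb-walk-to-root {ns = n ∷ ns} {x ∷ xs} 2≤ns g with comb-walk-to-root (2≤ns ∘ suc) (g ∘ suc)
... | k , w = _ , walk-++ (comb-center-head (2≤ns zero) g)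
                    (walk-map (center n ∷_) (comb-later (2≤ns zero)) w)

-- Any two points are joined through the root, and the taxicab distance to the root is the rank that
-- excludes cycles.
comb-isSpanningTree : {d : ℕ} {ns : Vec ℕ d} → (∀ i → 2 ≤ lookup ns i) → IsSpanningTree ns (Comb ns)
comb-isSpanningTree {ns = ns} 2≤ns =
  (λ { x y e@(gx , gy , _) → ∼⇒GridAdj ns gx gy (comb⇒∼ {ns = ns} e) }) ,
  (λ x y → comb-sym) ,
  (λ x y gx gy → _ , walk-++ (proj₂ (comb-walk-to-root 2≤ns gx))
                       (walk-reverse comb-sym (proj₂ (comb-walk-to-root 2≤ns gy)))) ,
  parents⇒acyclic (λ x → ∥ x - map center ns ∥) parent-lower parent-functional (proj₂ ∘ proj₂)

comb-stretch : {d : ℕ} {ns x y : Vec ℕ d} → (∀ i → 2 ≤ lookup ns i) → InGrid ns x → InGrid ns y →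
  x ∼ y → DistLe (Comb ns) x y (2 * halfSumInit ns + 1)
comb-stretch {ns = n ∷ ns} 2≤ns gx gy (now differ) with ±⇒toward (center n) differ
... | inj₁ t = 1 , m≤n+m 1 _ , step (gx , gy , inj₁ (now t)) here
... | inj₂ t = 1 , m≤n+m 1 _ , step (gx , gy , inj₂ (now t)) here
-- An edge in a later direction needs a further coordinate, so the head is not the last one and its
-- half side is a term of the sum. Centring it before and undoing this afterwards costs at most
-- `n / 2` each.
comb-stretch {ns = n ∷ ns@(_ ∷ _)} {x ∷ _} 2≤ns gx gy (later x∼y)
  with comb-stretch (2≤ns ∘ suc) (gx ∘ suc) (gy ∘ suc) x∼y
... | j , j≤ , w = _ , bound ,
  walk-++ (comb-center-head (2≤ns zero) gx)
    (walk-++ (walk-map (center n ∷_) (comb-later (2≤ns zero)) w)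
      (walk-reverse comb-sym (comb-center-head (2≤ns zero) gy)))
  where
  open ≤-Reasoning
  a = ∣ x - center n ∣
  h = halfSumInit ns
  bound : a + (j + a) ≤ 2 * (n / 2 + h) + 1
  bound = begin
    a + (j + a)                           ≤⟨ +-mono-≤ a≤ (+-mono-≤ j≤ a≤) ⟩
    n / 2 + ((2 * h + 1) + n / 2)         ≡⟨ rearrange (n / 2) h ⟩
    2 * (n / 2 + h) + 1                   ∎
    where
    a≤ = ∣x-center∣≤n/2 (gx zero)
    rearrange : ∀ p q → p + ((2 * q + 1) + p) ≡ 2 * (p + q) + 1
    rearrange = solve-∀

-- The far corner of a grid point

-- Unlike `halfSumInit`, this includes the last side; its half is given up later for the coordinate
-- lost along the line.
halfSum : {d : ℕ} → Vec ℕ d → ℕ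
halfSum []       = 0
halfSum (n ∷ ns) = n / 2 + halfSum ns

halfSum-last : {d : ℕ} (ns : Vec ℕ (suc d)) → halfSum ns ≡ halfSumInit ns + lookup ns (fromℕ d) / 2
halfSum-last (n ∷ [])         = +-identityʳ (n / 2)
halfSum-last (n ∷ ns@(_ ∷ _)) = trans (cong (n / 2 +_) (halfSum-last ns)) (sym (+-assoc (n / 2) _ _))

-- The threshold makes the chosen end of the side at least `n / 2` away: `w - 1` in the first case,
-- `n - w` in the second.
far : ℕ → ℕ → ℕ
far n w with n / 2 <? w
... | yes _ = 1
... | no  _ = n

far-between : ∀ {n w} → 1 ≤ w × w ≤ n → 1 ≤ far n w × far n w ≤ n
far-between {n} {w} (1≤w , w≤n) with n / 2 <? w
... | yes _ = ≤-refl , ≤-trans 1≤w w≤n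
... | no  _ = ≤-trans 1≤w w≤n , ≤-refl

n/2≤∣far-w∣ : ∀ n w → n / 2 ≤ ∣ far n w - w ∣
n/2≤∣far-w∣ n w with n / 2 <? w
n/2≤∣far-w∣ n (suc w) | yes n/2<w = s≤s⁻¹ n/2<w
... | no  n/2≮w = ≤-trans (m+n≤o⇒m≤o∸n (n / 2) (≤-trans (+-monoʳ-≤ (n / 2) (≮⇒≥ n/2≮w)) (2[n/2]≤n n)))
                    (m∸n≤∣m-n∣ n w)

farCorner : {d : ℕ} → Vec ℕ d → Vec ℕ d → Vec ℕ d
farCorner = zipWith far

farCorner-inGrid : {d : ℕ} (ns w : Vec ℕ d) → InGrid ns w → InGrid ns (farCorner ns w)
farCorner-inGrid (_ ∷ _)  (_ ∷ _)  g zero    = far-between (g zero)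
farCorner-inGrid (_ ∷ ns) (_ ∷ ws) g (suc i) = farCorner-inGrid ns ws (g ∘ suc) i

halfSum≤∥farCorner-w∥ : {d : ℕ} (ns w : Vec ℕ d) → halfSum ns ≤ ∥ farCorner ns w - w ∥
halfSum≤∥farCorner-w∥ []       []       = z≤n
halfSum≤∥farCorner-w∥ (n ∷ ns) (w ∷ ws) = +-mono-≤ (n/2≤∣far-w∣ n w) (halfSum≤∥farCorner-w∥ ns ws)

farCorner≢ : {d : ℕ} (ns w : Vec ℕ (suc d)) → (∀ i → 2 ≤ lookup ns i) → farCorner ns w ≢ w
farCorner≢ (n ∷ ns) (w ∷ ws) 2≤ns eq =
  contradiction (≤-trans (n/2≤∣far-w∣ n w) (≤-reflexive (m≡n⇒∣m-n∣≡0 (∷-injectiveˡ eq))))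
    (<⇒≱ (/-monoˡ-≤ 2 (2≤ns zero)))

-- `M` is the allowance for the one coordinate in which `p` need not be far from `w`.
Far : {d : ℕ} → ℕ → Vec ℕ d → Vec ℕ d → Vec ℕ d → Set
Far M ns w p = halfSum ns ≤ ∥ p - w ∥ + M

-- Far corners of adjacent points differ in at most one coordinate i, and moving in
-- direction i costs at most n_i / 2 of the distance to the two points.
farCorner-walk : {d M : ℕ} {ns w w′ : Vec ℕ d} → (∀ i → lookup ns i / 2 ≤ M) →
  InGrid ns w → InGrid ns w′ → w ∼ w′ →
  ∃[ k ] Walk (λ x y → GridAdj ns x y × Far M ns w′ x × Far M ns w y)
    (farCorner ns w) (farCorner ns w′) k
farCorner-walk {M = M} {ns} {w} {w′} bound gw gw′ w∼w′ with go bound gw gw′ w∼w′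
  where
  Good : ∀ {d} (ns w w′ p : Vec ℕ d) → Set
  Good ns w w′ p = InGrid ns p × Far M ns w p × Far M ns w′ p

  far-now : ∀ a {h l m} → m ≤ M → h ≤ l → m + h ≤ (a + l) + M
  far-now a {l = l} m≤M h≤l = ≤-trans (+-mono-≤ m≤M h≤l)
    (≤-trans (≤-reflexive (+-comm M l)) (+-monoˡ-≤ M (m≤n+m l a)))

  far-later : ∀ {a h l m} → m ≤ a → h ≤ l + M → m + h ≤ (a + l) + M
  far-later {a} m≤a h≤ = ≤-trans (+-mono-≤ m≤a h≤) (≤-reflexive (sym (+-assoc a _ M)))

  go : ∀ {d} {ns w w′ : Vec ℕ d} → (∀ i → lookup ns i / 2 ≤ M) →
    InGrid ns w → InGrid ns w′ → w ∼ w′ →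
    ∃[ k ] Walk (λ x y → x ∼ y × Good ns w w′ x × Good ns w w′ y) (farCorner ns w) (farCorner ns w′) k
  go {ns = n ∷ ns} {w ∷ ws} {w′ ∷ _} bound gw gw′ (now _) = _ ,
    walk-map (_∷ farCorner ns ws) (λ { (t , gu , gv) → now (toward⇒± t) , good gu , good gv })
      (toward-between-walk (far-between (gw zero)) (far-between (gw′ zero)))
    where
    good : ∀ {p} → 1 ≤ p × p ≤ n → Good (n ∷ ns) (w ∷ ws) (w′ ∷ ws) (p ∷ farCorner ns ws)
    good {p} gp = inGrid-∷ gp (farCorner-inGrid ns ws (gw ∘ suc)) ,
      far-now ∣ p - w ∣ (bound zero) (halfSum≤∥farCorner-w∥ ns ws) ,
      far-now ∣ p - w′ ∣ (bound zero) (halfSum≤∥farCorner-w∥ ns ws)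
  go {ns = n ∷ ns} {w ∷ ws} {_ ∷ ws′} bound gw gw′ (later w∼w′)
    with go (bound ∘ suc) (gw ∘ suc) (gw′ ∘ suc) w∼w′
  ... | k , walk = k , walk-map (far n w ∷_)
    (λ { (x∼y , gx , gy) → later x∼y , good gx , good gy }) walk
    where
    good : ∀ {p} → Good ns ws ws′ p → Good (n ∷ ns) (w ∷ ws) (w ∷ ws′) (far n w ∷ p)
    good (gp , fw , fw′) = inGrid-∷ (far-between (gw zero)) gp ,
      far-later (n/2≤∣far-w∣ n w) fw , far-later (n/2≤∣far-w∣ n w) fw′
-- Only these two bounds are kept, since the tree path across the cut will run from `x` to `w′` and
-- from `w` to `y`.
... | k , walk = k , walk-map id
  (λ { (x∼y , (gx , _ , fx) , (gy , fy , _)) → ∼⇒GridAdj ns gx gy x∼y , fx , fy }) walk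

-- Removing an edge or a vertex of a tree

Without : {V : Set} → (V → V → Set) → V → V → V → V → Set
Without T w w′ x y = T x y × ¬ (x ≡ w × y ≡ w′) × ¬ (x ≡ w′ × y ≡ w)

Avoiding : {V : Set} → (V → V → Set) → V → V → V → Set
Avoiding T w x y = T x y × x ≢ w × y ≢ w

Connected : {V : Set} → (V → V → Set) → V → V → Set
Connected R x y = ∃[ k ] Walk R x y k

-- In a tree, `y` is the last vertex before `w` on the path from `f w` to `w`.
Points : {V : Set} → (V → V → Set) → (V → V) → V → V → Set
Points T f w y = T y w × Connected (Avoiding T w) (f w) y

first-hit : {V : Set} {T : V → V → Set} {x w : V} {k : ℕ} → DecidableEquality V →
  Walk T x w k → x ≢ w → ∃[ y ] (T y w × Connected (Avoiding T w) x y)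
first-hit _≟_ here x≢x = contradiction refl x≢x
first-hit {w = w} _≟_ (step {y = z} e walk) x≢w with z ≟ w
... | yes refl = _ , e , 0 , here
... | no z≢w with first-hit _≟_ walk z≢w
...   | y , yw , k , v = y , yw , suc k , step (e , x≢w , z≢w) v

connected-step : {V : Set} {R : V → V → Set} {x y z : V} → R x y → Connected R y z → Connected R x z
connected-step e (k , w) = suc k , step e w

module _ {V : Set} (_≟_ : DecidableEquality V) {T : V → V → Set} (T-sym : ∀ {x y} → T x y → T y x)
         (acyclic : ¬ Cycle T) {w w′ : V} (w≢w′ : w ≢ w′) (ww′ : T w w′) where

  Cut : V → V → Set
  Cut = Without T w w′

  cut-sym : ∀ {x y} → Cut x y → Cut y x
  cut-sym (e , ¬p , ¬q) = T-sym e , ¬q ∘ swap , ¬p ∘ swap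

  cut-or-crossing : ∀ {x y} → T x y → Cut x y ⊎ (x ≡ w × y ≡ w′) ⊎ (x ≡ w′ × y ≡ w)
  cut-or-crossing {x} {y} e with x ≟ w | y ≟ w′ | x ≟ w′ | y ≟ w
  ... | yes p | yes q | _     | _     = inj₂ (inj₁ (p , q))
  ... | _     | _     | yes p | yes q = inj₂ (inj₂ (p , q))
  ... | no ¬p | _     | no ¬q | _     = inj₁ (e , ¬p ∘ proj₁ , ¬q ∘ proj₁)
  ... | no ¬p | _     | _     | no ¬q = inj₁ (e , ¬p ∘ proj₁ , ¬q ∘ proj₂)
  ... | _     | no ¬p | no ¬q | _     = inj₁ (e , ¬p ∘ proj₂ , ¬q ∘ proj₁)
  ... | _     | no ¬p | _     | no ¬q = inj₁ (e , ¬p ∘ proj₂ , ¬q ∘ proj₂)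

  -- Otherwise a walk from `w` to `w′` that does not use the edge between them would close up with
  -- that edge to a cycle.
  not-both-sides : ∀ {x} → Connected Cut x w → ¬ Connected Cut x w′
  not-both-sides (_ , p) (_ , q) = acyclic (close-walk _≟_ proj₁ (walk-++ (walk-reverse cut-sym p) q)
    w≢w′ (λ { (_ , ¬ww′ , _) → ¬ww′ (refl , refl) }) (T-sym ww′))

  -- The part of the walk before its first use of the removed edge survives the removal.
  side : ∀ {x k} → Walk T x w k → Connected Cut x w ⊎ Connected Cut x w′
  side here = inj₁ (0 , here)
  side (step e walk) with cut-or-crossing e
  ... | inj₂ (inj₁ (refl , _)) = inj₁ (0 , here)
  ... | inj₂ (inj₂ (refl , _)) = inj₂ (0 , here)
  ... | inj₁ e′ with side walk
  ...   | inj₁ c = inj₁ (connected-step e′ c)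
  ...   | inj₂ c = inj₂ (connected-step e′ c)

  -- Up to its first use of the removed edge the walk stays on the side of `w′`. That use therefore
  -- runs from `w′` to `w` and splits the walk.
  cross : ∀ {x y k} → Connected Cut x w′ → Connected Cut y w → Walk T x y k →
    ∃₂ λ i j → Walk T x w′ i × Walk T w y j × i + suc j ≡ k
  cross cx cy here = ⊥-elim (not-both-sides cy cx)
  cross cx cy (step e walk) with cut-or-crossing e
  ... | inj₂ (inj₁ (refl , _)) = ⊥-elim (not-both-sides (0 , here) cx)
  ... | inj₂ (inj₂ (refl , refl)) = 0 , _ , here , walk , refl
  ... | inj₁ e′ with cross (connected-step (cut-sym e′) cx) cy walk
  ...   | i , j , p , q , eq = suc i , j , step e p , q , cong suc eq

  -- A discrete intermediate value argument: the walk may leave the tree, but each of its vertices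
  -- lies on one of the two sides.
  crossing-step : ∀ {R : V → V → Set} {x y k} →
    (∀ {u v} → R u v → Connected T v w) → Connected Cut x w′ → Connected Cut y w →
    Walk R x y k → ∃₂ λ u v → R u v × Connected Cut u w′ × Connected Cut v w
  crossing-step reach cx cy here = ⊥-elim (not-both-sides cy cx)
  crossing-step reach cx cy (step e walk) with side (proj₂ (reach e))
  ... | inj₁ cv = _ , _ , e , cx , cv
  ... | inj₂ cv = crossing-step reach cv cy walk

-- The lower bound on the stretch

stretch-lower-bound : {d : ℕ} (ns : Vec ℕ (suc d)) → (∀ i → 2 ≤ lookup ns i) →
  ((i j : Fin (suc d)) → i ≤ᶠ j → lookup ns i ≤ lookup ns j) →
  ∀ T → IsSpanningTree ns T → ∀ k → StretchLe ns T k → 2 * halfSumInit ns + 1 ≤ k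
stretch-lower-bound {d} ns 2≤ns sorted T (T⇒adj , T-sym , connected , acyclic) k stretch
  with mutual-pointers {P = Points T (farCorner ns)} {G = InGrid ns} _≟ⱽ_ acyclic proj₁
         -- The search starts at `ns`, the corner with all coordinates maximal.
         (λ p e → T-irrefl (proj₁ p) (sym e)) next (gridPoints ns) (∈-gridPoints ns) ns
         (λ i → ≤-trans (s≤s z≤n) (2≤ns i) , ≤-refl)
  where
  _≟ⱽ_ : DecidableEquality (Vec ℕ (suc d))
  _≟ⱽ_ = ≡-dec _≟_

  T-irrefl : ∀ {x y} → T x y → x ≢ y
  T-irrefl e = ∼-irrefl (GridAdj⇒∼ ns (T⇒adj _ _ e))

  next : ∀ {x} → InGrid ns x → ∃[ y ] (InGrid ns y × Points T (farCorner ns) x y)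
  next {x} gx with first-hit _≟ⱽ_ (proj₂ (connected _ _ (farCorner-inGrid ns x gx) gx)) (farCorner≢ ns x 2≤ns)
  ... | y , yx , c = y , proj₁ (T⇒adj _ _ yx) , yx , c
... | w , w′ , gw , gw′ , (w′w , ka , pa) , (ww′ , kb , pb)
  with w≢w′ ← ∼-irrefl (GridAdj⇒∼ ns (T⇒adj _ _ ww′))
  -- The allowance is half of the last side, which is the largest because the sides are sorted.
  with farCorner-walk (λ i → /-monoˡ-≤ 2 (sorted i (fromℕ d) (≤fromℕ i))) gw gw′ (GridAdj⇒∼ ns (T⇒adj _ _ ww′))
... | _ , line
  with crossing-step (≡-dec _≟_) (T-sym _ _) acyclic w≢w′ ww′
         (λ { ((_ , gv , _) , _) → connected _ _ gv gw })
         -- A walk avoiding `w` or `w′` cannot use the edge between them, so the far corner of `w`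
         -- is on the side of `w′` and the far corner of `w′` on the side of `w`.
         (ka , walk-map id (λ { (e , x≢w , y≢w) → e , x≢w ∘ proj₁ , y≢w ∘ proj₂ }) pa)
         (kb , walk-map id (λ { (e , x≢w′ , y≢w′) → e , y≢w′ ∘ proj₂ , x≢w′ ∘ proj₁ }) pb)
         line
... | x , y , (xy , far-x , far-y) , cx , cy with stretch x y xy
... | l , l≤k , walk with cross (≡-dec _≟_) (T-sym _ _) acyclic w≢w′ ww′ cx cy walk
... | i , j , p , q , i+1+j≡l = begin
  2 * S + 1   ≡⟨ double S ⟩
  -- Each of the two parts of the tree path has length at least `S`; the extra 1 is the edge from
  -- `w′` to `w`.
  S + suc S   ≤⟨ +-mono-≤ (strip far-x p) (s≤s (strip far-y (walk-reverse (T-sym _ _) q))) ⟩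
  i + suc j   ≡⟨ i+1+j≡l ⟩
  l           ≤⟨ l≤k ⟩
  k           ∎
  where
  open ≤-Reasoning
  S = halfSumInit ns

  double : ∀ s → 2 * s + 1 ≡ s + suc s
  double = solve-∀

  strip : ∀ {u v m} → Far (lookup ns (fromℕ d) / 2) ns v u → Walk T u v m → S ≤ m
  strip far walk = ≤-trans
    (+-cancelʳ-≤ (lookup ns (fromℕ d) / 2) S _ (≤-trans (≤-reflexive (sym (halfSum-last ns))) far))
    (walk⇒∥-∥≤ (λ e → GridAdj⇒∼ ns (T⇒adj _ _ e)) walk)

theorem4p2 : (d : ℕ) → 1 ≤ d → (ns : Vec ℕ d) →
    ((i : Fin d) → 2 ≤ lookup ns i) →
    ((i j : Fin d) → i ≤ᶠ j → lookup ns i ≤ lookup ns j) →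
    TreeStretchIs ns (2 * halfSumInit ns + 1)
theorem4p2 (suc d) _ ns 2≤ns sorted =
  (Comb ns , comb-isSpanningTree 2≤ns ,
    λ { x y adj@(gx , gy , _) → comb-stretch 2≤ns gx gy (GridAdj⇒∼ ns adj) }) ,
  stretch-lower-bound ns 2≤ns sorted
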